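{- Let $g\ge 5$ be an integer. Then every positive integer can be written as a sum of three base $g$ palindromes.
   Context: Every nonnegative integer $n$ has a unique base $g$ representation $n=\sum_{j\ge 0}\delta_j g^j$ with digits $0\le\delta_j\le g-1$; if $n$ has $l$ digits, write $n=\delta_{l-1}\cdots\delta_0$ with $\delta_{l-1}\neq 0$. A positive integer $n$ with $l$ base $g$ digits is a base $g$ palindrome if $\delta_{l-i}=\delta_{i-1}$ for all $i=1,\dots,\lfloor l/2\rfloor$. By convention, $0$ is also considered a base $g$ palindrome (so a sum of three palindromes may have some summands equal to $0$). -}

module Defs where

open import Data.Nat using (ℕ; zero; suc; _+_; _*_)
open import Data.Fin using (Fin; toℕ)
open import Data.List using (List; []; _∷_; reverse; last)
open import Data.Maybe using (Maybe; just)
open import Data.Product using (∃; _×_; _,_)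
open import Data.Sum using (_⊎_)
open import Relation.Binary.PropositionalEquality using (_≡_; _≢_)
open import Data.Digit using (Expansion; fromDigits)

-- A list of base-g digits (least significant first) is a proper
-- representation if it is nonempty and its most significant digit is nonzero.
-- Such a representation of n is unique, so "the" digits of n > 0 are these.
ProperDigits : (g : ℕ) → Expansion g → Set
ProperDigits g ds = ∃ λ (d : Fin g) → last ds ≡ just d × toℕ d ≢ 0

IsPalindrome : (g : ℕ) → ℕ → Set
IsPalindrome g n =
  n ≡ 0 ⊎ ∃ λ (ds : Expansion g) →
    ProperDigits g ds × fromDigits ds ≡ n × reverse ds ≡ ds

{-# OPTIONS --safe #-}
-- Allow palindromic digit strings to start with zeros.  Suppose that every number in
-- [A , B] is a sum of three such strings of lengths l₁ ≥ l₂ ≥ l₃.  Surround the strings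
-- by outer digits x, y, z.  Given n, choose x and y greedily, so that the remainder M
-- after removing their contribution lies in a fixed window; the lowest digit forces
-- z = M mod g, and if the window is placed well, (M - z (1 + g ^ (l₃ + 1))) / g lies in
-- [A , B].  So an interval for (l₁ , l₂ , l₃) grows to one for (l₁+2 , l₂+2 , l₃+2).  As
-- nearly all values of y are available, x, y and z can moreover be chosen nonzero at the
-- outermost level, which gives genuine palindromes.  Starting from the lengths (3,2,1),
-- (4,3,1), (5,3,1) and (6,4,3), the resulting intervals overlap and exhaust the large
-- numbers; small numbers are reached by the starting lengths themselves, together with
-- (3,3,1) and (5,5,3).
module Submission where

open import Defs
open import Data.Bool using (Bool; true; T; _∧_)
open import Data.Bool.Properties using (T-∧)
open import Data.Digit using (Expansion; fromDigits)
open import Data.Fin using (Fin; zero; suc; toℕ; fromℕ<)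
open import Data.Fin.Properties using (toℕ-fromℕ<)
open import Data.List using (List; []; _∷_; _∷ʳ_; last; length; reverse)
open import Data.List.Properties using (reverse-++; unfold-reverse)
open import Data.Maybe using (just)
open import Data.Nat using (ℕ; zero; suc; _+_; _*_; _^_; _≤_; _<_; _≤ᵇ_; _≤?_; z≤n; s≤s; z<s; s≤s⁻¹;
  NonZero; >-nonZero)
open import Data.Nat.DivMod using (_%_; _/_; m≡m%n+[m/n]*n; m%n<n)
open import Data.Nat.Properties
open import Data.Nat.Tactic.RingSolver using (solve-∀)
open import Data.Product using (∃; _×_; _,_)
open import Data.Sum using (inj₁; inj₂)
open import Data.Unit using (tt)
open import Data.Vec using (Vec; []; _∷_; lookup; map)
open import Data.Vec.Properties using (lookup-map)
open import Function.Bundles using (Equivalence)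
open import Relation.Binary.PropositionalEquality using (_≡_; _≢_; refl; sym; trans; cong; cong₂;
  subst; subst₂; module ≡-Reasoning)
open import Relation.Nullary using (¬_; yes; no)

-- Polynomial inequalities over the naturals by reflection

infixl 6 _:+_
infixl 7 _:*_

data Expr (n : ℕ) : Set where
  con  : ℕ → Expr n
  var  : Fin n → Expr n
  _:+_ : Expr n → Expr n → Expr n
  _:*_ : Expr n → Expr n → Expr n

⟦_⟧ : ∀ {n} → Expr n → Vec ℕ n → ℕ
⟦ con c ⟧ ρ  = c
⟦ var i ⟧ ρ  = lookup ρ i
⟦ a :+ b ⟧ ρ = ⟦ a ⟧ ρ + ⟦ b ⟧ ρ
⟦ a :* b ⟧ ρ = ⟦ a ⟧ ρ * ⟦ b ⟧ ρ

_[_] : ∀ {m n} → Expr n → Vec (Expr m) n → Expr m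
con c    [ σ ] = con c
var i    [ σ ] = lookup σ i
(a :+ b) [ σ ] = a [ σ ] :+ b [ σ ]
(a :* b) [ σ ] = a [ σ ] :* b [ σ ]

⟦⟧-[] : ∀ {m n} (a : Expr n) (σ : Vec (Expr m) n) ρ → ⟦ a [ σ ] ⟧ ρ ≡ ⟦ a ⟧ (map (λ b → ⟦ b ⟧ ρ) σ)
⟦⟧-[] (con c)  σ ρ = refl
⟦⟧-[] (var i)  σ ρ = sym (lookup-map i (λ b → ⟦ b ⟧ ρ) σ)
⟦⟧-[] (a :+ b) σ ρ = cong₂ _+_ (⟦⟧-[] a σ ρ) (⟦⟧-[] b σ ρ)
⟦⟧-[] (a :* b) σ ρ = cong₂ _*_ (⟦⟧-[] a σ ρ) (⟦⟧-[] b σ ρ)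

-- Recursive dense form: the list holds the coefficients of the powers of the first variable,
-- constant term first, each a polynomial in the remaining variables.
Poly : ℕ → Set
Poly zero    = ℕ
Poly (suc n) = List (Poly n)

eval : ∀ n → Poly n → Vec ℕ n → ℕ
eval zero    c        ρ       = c
eval (suc n) []       ρ       = 0
eval (suc n) (p ∷ ps) (x ∷ ρ) = eval n p ρ + x * eval (suc n) ps (x ∷ ρ)

constant : ∀ n → ℕ → Poly n
constant zero    c = c
constant (suc n) c = constant n c ∷ []

variable′ : ∀ n → Fin n → Poly n
variable′ (suc n) zero    = constant n 0 ∷ constant n 1 ∷ []
variable′ (suc n) (suc i) = variable′ n i ∷ []

add : ∀ n → Poly n → Poly n → Poly n
add zero    c        d        = c + d
add (suc n) []       qs       = qs
add (suc n) (p ∷ ps) []       = p ∷ ps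
add (suc n) (p ∷ ps) (q ∷ qs) = add n p q ∷ add (suc n) ps qs

mul   : ∀ n → Poly n → Poly n → Poly n
scale : ∀ n → Poly n → List (Poly n) → List (Poly n)
mul zero    c        d  = c * d
mul (suc n) []       qs = []
mul (suc n) (p ∷ ps) qs = add (suc n) (scale n p qs) (constant n 0 ∷ mul (suc n) ps qs)
scale n p []       = []
scale n p (q ∷ qs) = mul n p q ∷ scale n p qs

-- Coefficientwise comparison, a list that ends early counting as padded with zeros. It is
-- sufficient for pointwise inequality because the variables take natural values; it does not decide
-- it.
leq : ∀ n → Poly n → Poly n → Bool
leq zero    c        d        = c ≤ᵇ d
leq (suc n) []       qs       = true
leq (suc n) (p ∷ ps) []       = leq n p (constant n 0) ∧ leq (suc n) ps []
leq (suc n) (p ∷ ps) (q ∷ qs) = leq n p q ∧ leq (suc n) ps qs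

normalise : ∀ {n} → Expr n → Poly n
normalise (con c)  = constant _ c
normalise (var i)  = variable′ _ i
normalise (a :+ b) = add _ (normalise a) (normalise b)
normalise (a :* b) = mul _ (normalise a) (normalise b)

eval-constant : ∀ n c ρ → eval n (constant n c) ρ ≡ c
eval-constant zero    c ρ       = refl
eval-constant (suc n) c (x ∷ ρ) =
  trans (cong₂ _+_ (eval-constant n c ρ) (*-zeroʳ x)) (+-identityʳ c)

eval-variable : ∀ n i ρ → eval n (variable′ n i) ρ ≡ lookup ρ i
eval-variable (suc n) zero (x ∷ ρ)
  rewrite eval-constant n 0 ρ | eval-constant n 1 ρ | *-zeroʳ x = *-identityʳ x
eval-variable (suc n) (suc i) (x ∷ ρ)
  rewrite eval-variable n i ρ | *-zeroʳ x = +-identityʳ _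

eval-add : ∀ n p q ρ → eval n (add n p q) ρ ≡ eval n p ρ + eval n q ρ
eval-add zero    p        q        ρ       = refl
eval-add (suc n) []       q        ρ       = refl
eval-add (suc n) (p ∷ ps) []       (x ∷ ρ) = sym (+-identityʳ _)
eval-add (suc n) (p ∷ ps) (q ∷ qs) (x ∷ ρ)
  rewrite eval-add n p q ρ | eval-add (suc n) ps qs (x ∷ ρ) =
  interchange (eval n p ρ) (eval n q ρ) x _ _
  where
  interchange : ∀ a b x c d → a + b + x * (c + d) ≡ a + x * c + (b + x * d)
  interchange = solve-∀

eval-mul   : ∀ n p q ρ → eval n (mul n p q) ρ ≡ eval n p ρ * eval n q ρ
eval-scale : ∀ n p qs x ρ → eval (suc n) (scale n p qs) (x ∷ ρ) ≡ eval n p ρ * eval (suc n) qs (x ∷ ρ)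
eval-mul zero    p        q  ρ       = refl
eval-mul (suc n) []       qs ρ       = refl
eval-mul (suc n) (p ∷ ps) qs (x ∷ ρ)
  rewrite eval-add (suc n) (scale n p qs) (constant n 0 ∷ mul (suc n) ps qs) (x ∷ ρ)
        | eval-scale n p qs x ρ | eval-constant n 0 ρ | eval-mul (suc n) ps qs (x ∷ ρ)
  = distribute (eval n p ρ) x _ _
  where
  distribute : ∀ a x b c → a * c + x * (b * c) ≡ (a + x * b) * c
  distribute = solve-∀
eval-scale n p []       x ρ = sym (*-zeroʳ (eval n p ρ))
eval-scale n p (q ∷ qs) x ρ
  rewrite eval-mul n p q ρ | eval-scale n p qs x ρ = distribute (eval n p ρ) _ x _
  where
  distribute : ∀ a b x c → a * b + x * (a * c) ≡ a * (b + x * c)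
  distribute = solve-∀

leq-sound : ∀ n p q ρ → T (leq n p q) → eval n p ρ ≤ eval n q ρ
leq-sound zero    p        q        ρ       t = ≤ᵇ⇒≤ p q t
leq-sound (suc n) []       q        ρ       t = z≤n
leq-sound (suc n) (p ∷ ps) []       (x ∷ ρ) t
  with Equivalence.to T-∧ t
... | t₁ , t₂ = ≤-trans
  (+-mono-≤ (leq-sound n p _ ρ t₁) (*-monoʳ-≤ x (leq-sound (suc n) ps [] (x ∷ ρ) t₂)))
  (≤-reflexive (cong₂ _+_ (eval-constant n 0 ρ) (*-zeroʳ x)))
leq-sound (suc n) (p ∷ ps) (q ∷ qs) (x ∷ ρ) t
  with Equivalence.to T-∧ t
... | t₁ , t₂ =
  +-mono-≤ (leq-sound n p q ρ t₁) (*-monoʳ-≤ x (leq-sound (suc n) ps qs (x ∷ ρ) t₂))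

eval-normalise : ∀ {n} (a : Expr n) ρ → eval n (normalise a) ρ ≡ ⟦ a ⟧ ρ
eval-normalise (con c)  ρ = eval-constant _ c ρ
eval-normalise (var i)  ρ = eval-variable _ i ρ
eval-normalise (a :+ b) ρ = trans (eval-add _ (normalise a) (normalise b) ρ)
  (cong₂ _+_ (eval-normalise a ρ) (eval-normalise b ρ))
eval-normalise (a :* b) ρ = trans (eval-mul _ (normalise a) (normalise b) ρ)
  (cong₂ _*_ (eval-normalise a ρ) (eval-normalise b ρ))

poly≤ : ∀ {n} (a b : Expr n) (ρ : Vec ℕ n) {_ : T (leq n (normalise a) (normalise b))} →
        ⟦ a ⟧ ρ ≤ ⟦ b ⟧ ρ
poly≤ a b ρ {t} = subst₂ _≤_ (eval-normalise a ρ) (eval-normalise b ρ)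
  (leq-sound _ (normalise a) (normalise b) ρ t)

-- Digit strings and genuine palindromes

-- Palindromic digit strings with leading zeros allowed, indexed by g ^ length and value.
data PalString (g : ℕ) : ℕ → ℕ → Set where
  empty  : PalString g 1 0
  single : ∀ {d} → d < g → PalString g (g * 1) d
  wrap   : ∀ {d P v} → d < g → PalString g P v → PalString g (g * (g * P)) (d * (1 + g * P) + g * v)

last-∷ʳ : ∀ {A : Set} (xs : List A) x → last (xs ∷ʳ x) ≡ just x
last-∷ʳ []           x = refl
last-∷ʳ (_ ∷ [])     x = refl
last-∷ʳ (_ ∷ y ∷ ys) x = last-∷ʳ (y ∷ ys) x

fromDigits-∷ʳ : ∀ {g} (ds : Expansion g) d →
                fromDigits (ds ∷ʳ d) ≡ fromDigits ds + toℕ d * g ^ length ds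
fromDigits-∷ʳ     []       d = trans (+-identityʳ _) (sym (*-identityʳ _))
fromDigits-∷ʳ {g} (c ∷ ds) d = trans
  (cong (λ n → toℕ c + n * g) (fromDigits-∷ʳ ds d))
  (shift (toℕ c) (fromDigits ds) (toℕ d) (g ^ length ds) g)
  where
  shift : ∀ c n d p g → c + (n + d * p) * g ≡ c + n * g + d * (g * p)
  shift = solve-∀

length-∷ʳ : ∀ {A : Set} (xs : List A) x → length (xs ∷ʳ x) ≡ suc (length xs)
length-∷ʳ []       x = refl
length-∷ʳ (_ ∷ xs) x = cong suc (length-∷ʳ xs x)

reverse-sandwich : ∀ {A : Set} (x : A) xs → reverse xs ≡ xs → reverse (x ∷ xs ∷ʳ x) ≡ x ∷ xs ∷ʳ x
reverse-sandwich x xs eq = trans (unfold-reverse x (xs ∷ʳ x))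
  (cong (_∷ʳ x) (trans (reverse-++ xs (x ∷ [])) (cong (x ∷_) eq)))

fromDigits-sandwich : ∀ {g} (d : Fin g) ds → fromDigits (d ∷ ds ∷ʳ d) ≡
                      toℕ d * (1 + g * g ^ length ds) + g * fromDigits ds
fromDigits-sandwich {g} d ds = trans
  (cong (λ n → toℕ d + n * g) (fromDigits-∷ʳ ds d))
  (expand (toℕ d) (fromDigits ds) (g ^ length ds) g)
  where
  expand : ∀ d n p g → d + (n + d * p) * g ≡ d * (1 + g * p) + g * n
  expand = solve-∀

-- This ties the index `P` to the length of an actual digit list, so that the weight `1 + g * P` of
-- an outer digit is the one that `fromDigits` assigns to it.
digits : ∀ {g P v} → PalString g P v →
         ∃ λ (ds : Expansion g) → fromDigits ds ≡ v × reverse ds ≡ ds × g ^ length ds ≡ P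
digits empty = [] , refl , refl , refl
digits {g} (single d<g) = fromℕ< d<g ∷ [] , trans (+-identityʳ _) (toℕ-fromℕ< d<g) , refl , refl
digits {g} (wrap d<g s) with digits s
... | ds , refl , rev , refl = d ∷ ds ∷ʳ d
  , trans (fromDigits-sandwich d ds)
      (cong (λ c → c * (1 + g * g ^ length ds) + g * fromDigits ds) (toℕ-fromℕ< d<g))
  , reverse-sandwich d ds rev
  , cong (λ l → g * g ^ l) (length-∷ʳ ds d)
  where d = fromℕ< d<g

wrap-palindrome : ∀ {g d P v} → 0 < d → d < g → PalString g P v →
                  IsPalindrome g (d * (1 + g * P) + g * v)
wrap-palindrome {g} 0<d d<g s with digits s
... | ds , refl , rev , refl = inj₂ (c ∷ ds ∷ʳ c , (c , last-∷ʳ (c ∷ ds) c , c≢0)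
  , trans (fromDigits-sandwich c ds)
      (cong (λ c → c * (1 + g * g ^ length ds) + g * fromDigits ds) (toℕ-fromℕ< d<g))
  , reverse-sandwich c ds rev)
  where
  c = fromℕ< d<g
  c≢0 : toℕ c ≢ 0
  c≢0 eq = <⇒≢ 0<d (sym (trans (sym (toℕ-fromℕ< d<g)) eq))

digit-palindrome : ∀ {g d} → d < g → IsPalindrome g d
digit-palindrome {d = zero}  d<g = inj₁ refl
digit-palindrome {d = suc d} d<g = inj₂
  (c ∷ [] , (c , refl , c≢0) , trans (+-identityʳ _) (toℕ-fromℕ< d<g) , refl)
  where
  c = fromℕ< d<g
  c≢0 : toℕ c ≢ 0
  c≢0 eq with trans (sym (toℕ-fromℕ< d<g)) eq
  ... | ()

-- Sums of three strings and overlapping translates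

Sum₃ : ℕ → ℕ → Set
Sum₃ g n = ∃ λ a → ∃ λ b → ∃ λ c →
  IsPalindrome g a × IsPalindrome g b × IsPalindrome g c × n ≡ a + b + c

StringSum : ℕ → ℕ → ℕ → ℕ → ℕ → Set
StringSum g P₁ P₂ P₃ n = ∃ λ u → ∃ λ v → ∃ λ w →
  PalString g P₁ u × PalString g P₂ v × PalString g P₃ w × n ≡ u + v + w

Cover : ℕ → ℕ → ℕ → ℕ → ℕ → ℕ → Set
Cover g P₁ P₂ P₃ A B = ∀ {n} → A ≤ n → n ≤ B → StringSum g P₁ P₂ P₃ n

-- The translates of `[a , b]` by multiples of `d` overlap or abut, since `d + a ≤ suc b`; hence
-- `k + 1` of them fill an interval. The recursion finds the smallest `x` that serves.
spread : ∀ d {a b} k {n} → d + a ≤ suc b → a ≤ n → n ≤ k * d + b →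
         ∃ λ x → ∃ λ r → x ≤ k × a ≤ r × r ≤ b × n ≡ x * d + r
spread d zero    {n} gap a≤n n≤b = 0 , n , z≤n , a≤n , n≤b , refl
spread d {a} {b} (suc k) {n} gap a≤n n≤kdb with n ≤? k * d + b
... | yes n≤ with spread d k gap a≤n n≤
...   | x , r , x≤k , a≤r , r≤b , eq = x , r , m≤n⇒m≤1+n x≤k , a≤r , r≤b , eq
spread d {a} {b} (suc k) {n} gap a≤n n≤kdb | no n≰
  with m≤n⇒∃[o]m+o≡n (≤-trans (≤-trans (≤-reflexive (sym (rearrange k d a)))
    (≤-trans (+-monoʳ-≤ (k * d) gap) (≤-reflexive (+-suc _ b)))) (≰⇒> n≰))
  where
  rearrange : ∀ k d a → k * d + (d + a) ≡ d + k * d + a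
  rearrange = solve-∀
... | o , refl = suc k , a + o , ≤-refl , m≤m+n a o
  , +-cancelˡ-≤ (suc k * d) _ _ (subst (_≤ suc k * d + b) (+-assoc (suc k * d) a o) n≤kdb)
  , +-assoc (suc k * d) a o

-- Growing a covered interval by outer digits

module Peeling (g e : ℕ) (g≡1+e : g ≡ suc e) where

  digit : ∀ {d} → d ≤ e → d < g
  digit d≤e = subst (_ <_) (sym g≡1+e) (s≤s d≤e)

  instance
    g-nonZero : NonZero g
    g-nonZero = >-nonZero (digit z≤n)

  -- Modulo `g` only the outer digit `z` matters, so it must be the lowest digit, and then `v` is
  -- `m - z * P`. Stating the lower bound with `e` in place of `z` gives one window for all values
  -- of `z`.
  peel-last : ∀ {A B P z m} → z ≤ e → g * A + e * (1 + g * P) ≤ z + g * m → z + g * m ≤ g * B →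
              ∃ λ v → A ≤ v × v ≤ B × z + g * m ≡ z * (1 + g * P) + g * v
  peel-last {A} {B} {P} {z} {m} z≤e lower upper
    with m≤n⇒∃[o]m+o≡n A+zP≤m
    where
    split : ∀ g A z P k → z + g * (A + z * P) + k * (1 + g * P) ≡ g * A + (z + k) * (1 + g * P)
    split = solve-∀
    A+zP≤m : A + z * P ≤ m
    A+zP≤m with m≤n⇒∃[o]m+o≡n z≤e
    ... | k , z+k≡e = *-cancelˡ-≤ g (+-cancelˡ-≤ z _ _ (≤-trans
      (≤-trans (m≤m+n _ (k * (1 + g * P)))
        (≤-reflexive (trans (split g A z P k) (cong (λ d → g * A + d * (1 + g * P)) z+k≡e)))) lower))
  ... | o , refl = A + o , m≤m+n A o
    , ≤-trans (+-monoˡ-≤ o (m≤m+n A (z * P))) (*-cancelˡ-≤ g (≤-trans (m≤n+m _ z) upper))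
    , regroup g A z P o
    where
    regroup : ∀ g A z P o → z + g * (A + z * P + o) ≡ z * (1 + g * P) + g * (A + o)
    regroup = solve-∀

  quotient-remainder : ∀ n → ∃ λ r → ∃ λ m → r ≤ e × n ≡ r + g * m
  quotient-remainder n = n % g , n / g , s≤s⁻¹ (subst (n % g <_) g≡1+e (m%n<n n g))
    , trans (m≡m%n+[m/n]*n n g) (cong (n % g +_) (*-comm (n / g) g))

  module _ {P₁ P₂ P₃ A B : ℕ} (cover : Cover g P₁ P₂ P₃ A B) where

    private
      W₁ W₂ a : ℕ
      W₁ = 1 + g * P₁
      W₂ = 1 + g * P₂
      a = g * A + e * (1 + g * P₃)

      regroup : ∀ x y z g p q r → x + (y + (z + g * (p + q + r))) ≡ x + g * p + (y + g * q) + (z + g * r)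
      regroup = solve-∀

    -- The window `[a , g * B]` suits every last digit. By `gap₂` its translates by `W₂` join up,
    -- and by `gap₁` so do the translates by `W₁` of the resulting interval.
    grow : W₂ + a ≤ suc (g * B) → W₁ + a ≤ suc (e * W₂ + g * B) →
           Cover g (g * (g * P₁)) (g * (g * P₂)) (g * (g * P₃)) a (e * W₁ + (e * W₂ + g * B))
    grow gap₂ gap₁ a≤n n≤
      with spread W₁ e gap₁ a≤n n≤
    ... | x , _ , x≤e , a≤ , ≤b , refl
      with spread W₂ e gap₂ a≤ ≤b
    ... | y , n , y≤e , a≤n , n≤b , refl
      with quotient-remainder n
    ... | z , m , z≤e , refl
      with peel-last {A} {B} {P₃} z≤e a≤n n≤b
    ... | v , A≤v , v≤B , eq
      with cover A≤v v≤B
    ... | p , q , r , sp , sq , sr , refl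
      = _ , _ , _ , wrap (digit x≤e) sp , wrap (digit y≤e) sq , wrap (digit z≤e) sr
      , trans (cong (λ n → x * W₁ + (y * W₂ + n)) eq)
          (regroup (x * W₁) (y * W₂) (z * (1 + g * P₃)) g p q r)

    finish : ∀ {x y z m} → 0 < x → x ≤ e → 0 < y → y ≤ e → 0 < z → z ≤ e →
             a ≤ z + g * m → z + g * m ≤ g * B → Sum₃ g (x * W₁ + (y * W₂ + (z + g * m)))
    finish {x} {y} {z} 0<x x≤e 0<y y≤e 0<z z≤e lower upper
      with peel-last {A} {B} {P₃} z≤e lower upper
    ... | v , A≤v , v≤B , eq
      with cover A≤v v≤B
    ... | p , q , r , sp , sq , sr , refl
      = _ , _ , _ , wrap-palindrome 0<x (digit x≤e) sp , wrap-palindrome 0<y (digit y≤e) sq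
      , wrap-palindrome 0<z (digit z≤e) sr
      , trans (cong (λ n → x * W₁ + (y * W₂ + n)) eq)
          (regroup (x * W₁) (y * W₂) (z * (1 + g * P₃)) g p q r)

    -- One copy of `W₁` and one of `W₂` are set aside, so `x` and `y` count the excess of the outer
    -- digits over 1. The remainder is kept above `W₂ + a` rather than `a`, and `2 + ky ≤ e` leaves
    -- room for one more unit: both serve the case where the last digit is zero.
    top : ∀ kx ky → 1 + kx ≤ e → 2 + ky ≤ e →
          W₂ + (W₂ + a) ≤ suc (g * B) → W₁ + (W₂ + a) ≤ suc (ky * W₂ + g * B) →
          ∀ {n} → W₁ + (W₂ + (W₂ + a)) ≤ n → n ≤ W₁ + (W₂ + (kx * W₁ + (ky * W₂ + g * B))) →
          Sum₃ g n
    top kx ky kx≤ ky≤ gap₂ gap₁ lower upper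
      with m≤n⇒∃[o]m+o≡n (≤-trans (≤-reflexive (+-assoc W₁ W₂ _)) lower)
    ... | o , refl
      with spread W₁ {W₂ + a} {ky * W₂ + g * B} kx {W₂ + a + o} gap₁ (m≤m+n _ o)
             (+-cancelˡ-≤ (W₁ + W₂) _ _
               (subst₂ _≤_ (+-assoc (W₁ + W₂) _ o) (sym (+-assoc W₁ W₂ _)) upper))
    ... | x , _ , x≤ , a≤ , ≤b , eq
      with spread W₂ {W₂ + a} {g * B} ky gap₂ a≤ ≤b
    ... | y , n , y≤ , a≤n , n≤b , refl
      with quotient-remainder n
    ... | suc z , m , z≤e , refl
      = subst (Sum₃ g) (sym (trans (+-assoc (W₁ + W₂) _ o)
            (trans (cong (W₁ + W₂ +_) eq) (collect W₁ W₂ x y _))))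
          (finish z<s (≤-trans (s≤s x≤) kx≤) z<s (≤-trans (s≤s y≤) (≤-trans (n≤1+n _) ky≤)) z<s z≤e
            (m+n≤o⇒n≤o W₂ a≤n) n≤b)
      where
      collect : ∀ w₁ w₂ x y n → w₁ + w₂ + (x * w₁ + (y * w₂ + n)) ≡ (1 + x) * w₁ + ((1 + y) * w₂ + n)
      collect = solve-∀
    -- If z = 0, raising the second leading digit by one turns z into g - 1.
    ... | zero , m , z≤e , refl
      with m≤n⇒∃[o]m+o≡n {suc P₂} {m} (*-cancelˡ-< g P₂ m (m+n≤o⇒m≤o W₂ a≤n))
    ... | m′ , refl
      = subst (Sum₃ g) (sym (trans (+-assoc (W₁ + W₂) _ o) (trans (cong (W₁ + W₂ +_) eq)
            (trans (cong (λ n → W₁ + W₂ + (x * W₁ + (y * W₂ + n))) (borrow P₂ m′))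
              (collect W₁ W₂ x y (e + g * m′))))))
          (finish z<s (≤-trans (s≤s x≤) kx≤) z<s (≤-trans (s≤s (s≤s y≤)) ky≤)
            (≤-trans (s≤s z≤n) ky≤) ≤-refl
            (+-cancelˡ-≤ W₂ _ _ (≤-trans a≤n (≤-reflexive (borrow P₂ m′))))
            (≤-trans (m≤n+m _ W₂) (≤-trans (≤-reflexive (sym (borrow P₂ m′))) n≤b)))
      where
      borrow : ∀ p m → g * (suc p + m) ≡ 1 + g * p + (e + g * m)
      borrow p m rewrite g≡1+e = expand e p m
        where
        expand : ∀ e p m → suc e * (suc p + m) ≡ 1 + suc e * p + (e + suc e * m)
        expand = solve-∀
      collect : ∀ w₁ w₂ x y n → w₁ + w₂ + (x * w₁ + (y * w₂ + (w₂ + n))) ≡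
                (1 + x) * w₁ + ((2 + y) * w₂ + n)
      collect = solve-∀

-- Inequalities in the base, for g at least 5

-- g - 1, g - 2 and g - 3 are variables tied to g by equations: this avoids truncated
-- subtraction and keeps every product neutral, so that terms do not unfold.
module LargeBase (g e f d h : ℕ)
  (g≡5+h : g ≡ 5 + h) (e≡4+h : e ≡ 4 + h) (f≡3+h : f ≡ 3 + h) (d≡2+h : d ≡ 2 + h) where

  e≡1+f : e ≡ suc f
  e≡1+f = trans e≡4+h (cong suc (sym f≡3+h))

  g≡1+e : g ≡ suc e
  g≡1+e = trans g≡5+h (cong suc (sym e≡4+h))

  open Peeling g e g≡1+e

  private
    G E F D J : Expr 5
    G = var zero
    E = var (suc zero)
    F = var (suc (suc zero))
    D = var (suc (suc (suc zero)))
    J = var (suc (suc (suc (suc zero))))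

    at : ℕ → Vec ℕ 5
    at j = g ∷ e ∷ f ∷ d ∷ j ∷ []

    -- In terms of h = g - 5 the inequalities needed below hold coefficient by coefficient.
    shifts : Expr 2 → Vec (Expr 2) 5
    shifts s = con 5 :+ var zero ∷ con 4 :+ var zero ∷ con 3 :+ var zero ∷ con 2 :+ var zero ∷ s ∷ []

    Dominates : Expr 2 → Expr 5 → Expr 5 → Set
    Dominates s a b = T (leq 2 (normalise (a [ shifts s ])) (normalise (b [ shifts s ])))

    dominate : ∀ s a b j → Dominates s a b → let k = ⟦ s ⟧ (h ∷ j ∷ []) in
               ⟦ a ⟧ (at k) ≤ ⟦ b ⟧ (at k)
    dominate s a b j t rewrite g≡5+h | e≡4+h | f≡3+h | d≡2+h =
      subst₂ _≤_ (⟦⟧-[] a (shifts s) (h ∷ j ∷ [])) (⟦⟧-[] b (shifts s) (h ∷ j ∷ []))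
        (poly≤ (a [ shifts s ]) (b [ shifts s ]) (h ∷ j ∷ []) {t})

    -- The hidden premise evaluates to the unit type, so each use is settled by normalisation. The
    -- fifth variable is 0 here, an arbitrary `j` in `boundᵥ`.
    bound : ∀ a b {_ : Dominates (con 0) a b} → ⟦ a ⟧ (at 0) ≤ ⟦ b ⟧ (at 0)
    bound a b {t} = dominate (con 0) a b 0 t

    boundᵥ : ∀ a b j {_ : Dominates (var (suc zero)) a b} → ⟦ a ⟧ (at j) ≤ ⟦ b ⟧ (at j)
    boundᵥ a b j {t} = dominate (var (suc zero)) a b j t

    -- Replacing `j` by `1 + j` makes positivity of `j` visible in the coefficients.
    Dominates⁺ : Expr 5 → Expr 5 → Set
    Dominates⁺ = Dominates (con 1 :+ var (suc zero))

    bound⁺ : ∀ a b {j} → 0 < j → Dominates⁺ a b → ⟦ a ⟧ (at j) ≤ ⟦ b ⟧ (at j)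
    bound⁺ a b {suc j} _ t = dominate (con 1 :+ var (suc zero)) a b j t

  private
    -- The subscript is a length: `W₄` is 1 + g³, the weight of the outer digit of a string of
    -- length 4. `V₄` is its syntactic form.
    W₂ W₃ W₄ W₅ W₆ : ℕ
    W₂ = 1 + g * 1
    W₃ = 1 + g * (g * 1)
    W₄ = 1 + g * (g * (g * 1))
    W₅ = 1 + g * (g * (g * (g * 1)))
    W₆ = 1 + g * (g * (g * (g * (g * 1))))

    V₂ V₃ V₄ V₅ V₆ : Expr 5
    V₂ = con 1 :+ G :* con 1
    V₃ = con 1 :+ G :* (G :* con 1)
    V₄ = con 1 :+ G :* (G :* (G :* con 1))
    V₅ = con 1 :+ G :* (G :* (G :* (G :* con 1)))
    V₆ = con 1 :+ G :* (G :* (G :* (G :* (G :* con 1))))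

    ≤e : ∀ {d} → d ≤ f → suc d ≤ e
    ≤e d≤f = subst (_ ≤_) (sym e≡1+f) (s≤s d≤f)

    ≤f : ∀ {d} → suc d ≤ e → d ≤ f
    ≤f d<e = s≤s⁻¹ (subst (_ ≤_) e≡1+f d<e)

    g≤1+e : g ≤ suc e
    g≤1+e = ≤-reflexive g≡1+e

    1≤e : 1 ≤ e
    1≤e = bound (con 1) E

    gap₀ : ∀ {d b} → d ≤ suc b → d + 0 ≤ suc b
    gap₀ = subst (_≤ _) (sym (+-identityʳ _))

  -- Lengths (3,2,1) and numbers of at most three digits

  two-digits : ∀ {n} → n ≤ e * g + e → ∃ λ y → ∃ λ t → y ≤ e × t ≤ e × n ≡ y * g + t
  two-digits n≤ with spread g {0} {e} e (gap₀ g≤1+e) z≤n n≤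
  ... | y , t , y≤e , _ , t≤e , eq = y , t , y≤e , t≤e , eq

  -- Greedy choice along the weights `W₃`, `W₂`, `g`, 1. The inner digit of the first string and the
  -- single digit of the third together form any number below g². As 0 is reached, any lower end
  -- will do.
  cover-321 : ∀ {A} → Cover g (g * (g * (g * 1))) (g * (g * 1)) (g * 1)
                A (g * (g * (g * 1)) + g * (g * 1))
  cover-321 _ n≤
    with spread W₃ {0} e (gap₀ (bound V₃ (con 1 :+ (E :* V₂ :+ (E :* G :+ E))))) z≤n
           (≤-trans n≤ (bound (G :* (G :* (G :* con 1)) :+ G :* (G :* con 1))
                              (E :* V₃ :+ (E :* V₂ :+ (E :* G :+ E)))))
  ... | x , _ , x≤e , _ , n≤ , refl
    with spread W₂ {0} e (gap₀ (bound V₂ (con 1 :+ (E :* G :+ E)))) z≤n n≤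
  ... | u , _ , u≤e , _ , n≤ , refl
    with two-digits n≤
  ... | y , t , y≤e , t≤e , refl
    = _ , _ , _ , wrap (digit x≤e) (single (digit y≤e)) , wrap (digit u≤e) empty , single (digit t≤e)
    , regroup x u y t g
    where
    regroup : ∀ x u y t g → x * (1 + g * (g * 1)) + (u * (1 + g * 1) + (y * g + t)) ≡
                            x * (1 + g * (g * 1)) + g * y + (u * (1 + g * 1) + g * 0) + t
    regroup = solve-∀

  pair-palindrome : ∀ {d} → d ≤ e → IsPalindrome g (d * W₂ + g * 0)
  pair-palindrome {zero}  d≤e = inj₁ (*-zeroʳ g)
  pair-palindrome {suc d} d≤e = wrap-palindrome z<s (digit d≤e) empty

  -- A string of two equal digits leaves a remainder of at most `g`. The remainder `g` is not a
  -- digit, but it is `e + 1`.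
  short : ∀ {n} → n ≤ e * W₂ + g → Sum₃ g n
  short n≤ with spread W₂ {0} {g} e (gap₀ (bound V₂ (con 1 :+ G))) z≤n n≤
  ... | q , r , q≤e , _ , r≤g , refl with r ≤? e
  ...   | yes r≤e = _ , _ , 0 , pair-palindrome q≤e , digit-palindrome (digit r≤e) , inj₁ refl
            , regroup q r g
    where
    regroup : ∀ q r g → q * (1 + g * 1) + r ≡ q * (1 + g * 1) + g * 0 + r + 0
    regroup = solve-∀
  ...   | no r≰e with ≤-antisym r≤g (≤-trans g≤1+e (≰⇒> r≰e))
  ...     | refl = _ , _ , _ , pair-palindrome q≤e , digit-palindrome (digit ≤-refl)
            , digit-palindrome (digit 1≤e) , regroup q
    where
    regroup : ∀ q → q * W₂ + g ≡ q * W₂ + g * 0 + e + 1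
    regroup q rewrite g≡1+e = expand q e
      where
      expand : ∀ q e → q * (1 + suc e * 1) + suc e ≡ q * (1 + suc e * 1) + suc e * 0 + e + 1
      expand = solve-∀

  up-to-three-digits : ∀ {n} → n ≤ e * W₃ + g * g → Sum₃ g n
  up-to-three-digits n≤
    with spread W₃ {0} {g * g} e (gap₀ (bound V₃ (con 1 :+ G :* G))) z≤n n≤
  ... | zero , n , _ , _ , n≤g² , refl = short (≤-trans n≤g² (bound (G :* G) (E :* V₂ :+ G)))
  ... | suc x , n , x≤e , _ , n≤g² , refl with n ≤? e * g + e
  ...   | yes n≤ with two-digits n≤
  ...     | y , t , y≤e , t≤e , refl = _ , _ , 0
            , wrap-palindrome z<s (digit x≤e) (single (digit y≤e))
            , digit-palindrome (digit t≤e) , inj₁ refl , regroup (suc x) y t g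
    where
    regroup : ∀ x y t g → x * (1 + g * (g * 1)) + (y * g + t) ≡ x * (1 + g * (g * 1)) + g * y + t + 0
    regroup = solve-∀
  up-to-three-digits n≤ | suc x , n , x≤e , _ , n≤g² , refl | no n≰
    -- The one remaining value is g² = g e + e + 1: inner digit `e` and the summands `e` and 1.
    with ≤-antisym n≤g² (≤-trans (bound (G :* G) (con 1 :+ (E :* G :+ E))) (≰⇒> n≰))
  ... | refl = _ , _ , _ , wrap-palindrome z<s (digit x≤e) (single (digit ≤-refl))
             , digit-palindrome (digit ≤-refl) , digit-palindrome (digit 1≤e) , regroup (suc x)
    where
    regroup : ∀ x → x * W₃ + g * g ≡ x * W₃ + g * e + e + 1
    regroup x rewrite g≡1+e = expand x e
      where
      expand : ∀ x e → x * (1 + suc e * (suc e * 1)) + suc e * suc e ≡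
                       x * (1 + suc e * (suc e * 1)) + suc e * e + e + 1
      expand = solve-∀

  -- Lengths (3,3,1)

  -- Greedy choice along `W₃`, `W₃`, `g`, `g`, 1. Outer digits up to `k = e` allow leading zeros;
  -- with `k = f` a unit can still be added to each, making it nonzero.
  split-331 : ∀ k {n} → n ≤ k * W₃ + (k * W₃ + (e * g + (e * g + e))) →
              ∃ λ x → ∃ λ x′ → ∃ λ y → ∃ λ y′ → ∃ λ t →
                x ≤ k × x′ ≤ k × y ≤ e × y′ ≤ e × t ≤ e ×
                n ≡ x * W₃ + g * y + (x′ * W₃ + g * y′) + t
  split-331 k n≤
    with spread W₃ {0} k (gap₀ (≤-trans W₃≤ (s≤s (m≤n+m _ (k * W₃))))) z≤n n≤
    where
    W₃≤ : W₃ ≤ suc (e * g + (e * g + e))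
    W₃≤ = bound V₃ (con 1 :+ (E :* G :+ (E :* G :+ E)))
  ... | x , _ , x≤k , _ , n≤ , refl
    with spread W₃ {0} k (gap₀ (bound V₃ (con 1 :+ (E :* G :+ (E :* G :+ E))))) z≤n n≤
  ... | x′ , _ , x′≤k , _ , n≤ , refl
    with spread g {0} e (gap₀ (bound G (con 1 :+ (E :* G :+ E)))) z≤n n≤
  ... | y , _ , y≤e , _ , n≤ , refl
    with two-digits n≤
  ... | y′ , t , y′≤e , t≤e , refl
    = x , x′ , y , y′ , t , x≤k , x′≤k , y≤e , y′≤e , t≤e , regroup x x′ y y′ t g
    where
    regroup : ∀ x x′ y y′ t g → let w = 1 + g * (g * 1) in
              x * w + (x′ * w + (y * g + (y′ * g + t))) ≡ x * w + g * y + (x′ * w + g * y′) + t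
    regroup = solve-∀

  top-331 : ∀ {n} → W₃ + W₃ ≤ n → n ≤ W₃ + W₃ + (f * W₃ + (f * W₃ + (e * g + (e * g + e)))) →
            Sum₃ g n
  top-331 n≥ n≤ with m≤n⇒∃[o]m+o≡n n≥
  ... | o , refl with split-331 f (+-cancelˡ-≤ (W₃ + W₃) _ _ n≤)
  ...   | x , x′ , y , y′ , t , x≤ , x′≤ , y≤e , y′≤e , t≤e , refl
    = _ , _ , _ , wrap-palindrome z<s (digit (≤e x≤)) (single (digit y≤e))
    , wrap-palindrome z<s (digit (≤e x′≤)) (single (digit y′≤e)) , digit-palindrome (digit t≤e)
    , regroup W₃ x x′ (g * y) (g * y′) t
    where
    regroup : ∀ w x x′ y y′ t → w + w + (x * w + y + (x′ * w + y′) + t) ≡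
                                (1 + x) * w + y + ((1 + x′) * w + y′) + t
    regroup = solve-∀

  -- Lengths (4,3,1)

  -- The least admissible outer digit of the second string is `j`. The greedy choice keeps reserves,
  -- `y ≤ f` and a second outer digit of at least `1 + j`, so that raising the one and lowering the
  -- other stays in range.
  split-431 : ∀ j k → j ≤ 1 → ∀ {n} → (1 + j) * W₃ ≤ n →
              n ≤ k * W₄ + (f * (g * W₂) + (e * W₃ + g * g)) →
              ∃ λ x → ∃ λ y → ∃ λ u → ∃ λ v → ∃ λ t →
                x ≤ k × y ≤ e × j ≤ u × u ≤ e × v ≤ e × t ≤ e ×
                n ≡ x * W₄ + g * (y * W₂ + g * 0) + (u * W₃ + g * v) + t
  split-431 j k j≤1 n≥ n≤
    with spread W₄ {(1 + j) * W₃} k gap₄ n≥ n≤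
    where
    gap₄ : W₄ + (1 + j) * W₃ ≤ suc (f * (g * W₂) + (e * W₃ + g * g))
    gap₄ = ≤-trans (+-monoʳ-≤ W₄ (*-monoˡ-≤ W₃ (s≤s j≤1)))
      (bound (V₄ :+ con 2 :* V₃) (con 1 :+ (F :* (G :* V₂) :+ (E :* V₃ :+ G :* G))))
  ... | x , _ , x≤k , n≥ , n≤ , refl
    with spread (g * W₂) {(1 + j) * W₃} f gap₂ n≥ n≤
    where
    gap₂ : g * W₂ + (1 + j) * W₃ ≤ suc (e * W₃ + g * g)
    gap₂ = ≤-trans (+-monoʳ-≤ (g * W₂) (*-monoˡ-≤ W₃ (s≤s j≤1)))
      (bound (G :* V₂ :+ con 2 :* V₃) (con 1 :+ (E :* V₃ :+ G :* G)))
  ... | y , _ , y≤ , n≥ , n≤ , refl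
    with spread W₃ {0} {g * g} e (gap₀ (bound V₃ (con 1 :+ G :* G))) z≤n n≤
  ... | q , w , q≤e , _ , w≤g² , refl
    -- As `w ≤ g * g < W₃`, the lower bound `(1 + j) * W₃` forces `q` to be at least `1 + j`, so `q`
    -- is a successor.
    with *-cancelʳ-< W₃ (1 + j) (1 + q) (≤-trans (s≤s n≥)
           (≤-trans (≤-reflexive (sym (+-suc (q * W₃) w)))
           (≤-trans (+-monoʳ-≤ (q * W₃) (≤-trans (s≤s w≤g²) (bound (con 1 :+ G :* G) V₃)))
             (≤-reflexive (+-comm (q * W₃) W₃)))))
  ... | s≤s (s≤s {n = u} j≤u) with w ≤? e * g + e
  ...   | yes w≤ with two-digits w≤
  ...     | v , t , v≤e , t≤e , refl
    = x , y , suc u , v , t , x≤k , ≤-trans (n≤1+n _) (≤e y≤) , m≤n⇒m≤1+n j≤u , q≤e , v≤e , t≤e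
    , regroup (x * W₄) y (suc u * W₃) v t g
    where
    regroup : ∀ x y u v t g → x + (y * (g * (1 + g * 1)) + (u + (v * g + t))) ≡
                              x + g * (y * (1 + g * 1) + g * 0) + (u + g * v) + t
    regroup = solve-∀
  -- The palindromes u v u plus one digit miss the values u(g² + 1) + g²; these are
  -- reached by raising the inner digit of the first palindrome and lowering u.
  split-431 j k j≤1 n≥ n≤ | x , _ , x≤k , _ , _ , refl
    | y , _ , y≤ , _ , _ , refl | q , w , q≤e , _ , w≤g² , refl | s≤s (s≤s {n = u} j≤u) | no w≰
    with ≤-antisym w≤g² (≤-trans (bound (G :* G) (con 1 :+ (E :* G :+ E))) (≰⇒> w≰))
  ... | refl
    = x , suc y , u , e , 1 , x≤k , ≤e y≤ , j≤u , ≤-trans (n≤1+n u) q≤e , ≤-refl , 1≤e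
    , regroup (x * W₄) y u
    where
    regroup : ∀ x y u → x + (y * (g * W₂) + (suc u * W₃ + g * g)) ≡
              x + g * (suc y * W₂ + g * 0) + (u * W₃ + g * e) + 1
    regroup x y u rewrite g≡1+e = expand x y u e
      where
      expand : ∀ x y u e → let g = suc e in
               x + (y * (g * (1 + g * 1)) + (suc u * (1 + g * (g * 1)) + g * g)) ≡
               x + g * (suc y * (1 + g * 1) + g * 0) + (u * (1 + g * (g * 1)) + g * e) + 1
      expand = solve-∀

  cover-431 : Cover g (g * (g * (g * (g * 1)))) (g * (g * (g * 1))) (g * 1)
                (g * (g * 1) + 1) (g * (g * (g * (g * 1))) + f * (g * (g * 1)))
  cover-431 n≥ n≤
    with split-431 0 e z≤n (≤-trans (bound (con 1 :* V₃) (G :* (G :* con 1) :+ con 1)) n≥)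
           (≤-trans n≤ (bound (G :* (G :* (G :* (G :* con 1))) :+ F :* (G :* (G :* con 1)))
                              (E :* V₄ :+ (F :* (G :* V₂) :+ (E :* V₃ :+ G :* G)))))
  ... | x , y , u , v , t , x≤e , y≤e , _ , u≤e , v≤e , t≤e , eq
    = _ , _ , _ , wrap (digit x≤e) (wrap (digit y≤e) empty) , wrap (digit u≤e) (single (digit v≤e))
    , single (digit t≤e) , eq

  top-431 : ∀ {n} → W₄ + 2 * W₃ ≤ n → n ≤ W₄ + (f * W₄ + (f * (g * W₂) + (e * W₃ + g * g))) →
            Sum₃ g n
  top-431 n≥ n≤ with m≤n⇒∃[o]m+o≡n (m+n≤o⇒m≤o W₄ n≥)
  ... | o , refl with split-431 1 f ≤-refl (+-cancelˡ-≤ W₄ _ _ n≥) (+-cancelˡ-≤ W₄ _ _ n≤)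
  ...   | x , y , u , v , t , x≤ , y≤e , 0<u , u≤e , v≤e , t≤e , refl
    = _ , _ , _ , wrap-palindrome z<s (digit (≤e x≤)) (wrap (digit y≤e) empty)
    , wrap-palindrome 0<u (digit u≤e) (single (digit v≤e)) , digit-palindrome (digit t≤e)
    , regroup W₄ x (g * (y * W₂ + g * 0)) (u * W₃ + g * v) t
    where
    regroup : ∀ w x y u t → w + (x * w + y + u + t) ≡ (1 + x) * w + y + u + t
    regroup = solve-∀

  -- Lengths (5,3,1)

  -- Greedy choice, in which the middle digits `z`, `v` and the digit `t` form an arbitrary
  -- three-digit number. Outer digits go up to `e` for `j = 1`, and up to `f` for `j = 0`, when they
  -- are raised by one afterwards.
  split-531 : ∀ j {n} → let k = j + f in
              n ≤ k * W₅ + (e * (g * W₃) + (k * W₃ + (e * (g * g) + (e * g + e)))) →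
              ∃ λ x → ∃ λ y → ∃ λ z → ∃ λ u → ∃ λ v → ∃ λ t →
                x ≤ k × y ≤ e × z ≤ e × u ≤ k × v ≤ e × t ≤ e ×
                n ≡ x * W₅ + g * (y * W₃ + g * z) + (u * W₃ + g * v) + t
  split-531 j n≤
    with spread W₅ {0} (j + f) (gap₀ (boundᵥ V₅
           (con 1 :+ (E :* (G :* V₃) :+
             ((J :+ F) :* V₃ :+ (E :* (G :* G) :+ (E :* G :+ E))))) j)) z≤n n≤
  ... | x , _ , x≤k , _ , n≤ , refl
    with spread (g * W₃) {0} e (gap₀ (boundᵥ (G :* V₃)
           (con 1 :+ ((J :+ F) :* V₃ :+ (E :* (G :* G) :+ (E :* G :+ E)))) j)) z≤n n≤
  ... | y , _ , y≤e , _ , n≤ , refl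
    with spread W₃ {0} (j + f) (gap₀ (bound V₃ (con 1 :+ (E :* (G :* G) :+ (E :* G :+ E))))) z≤n n≤
  ... | u , _ , u≤k , _ , n≤ , refl
    with spread (g * g) {0} e (gap₀ (bound (G :* G) (con 1 :+ (E :* G :+ E)))) z≤n n≤
  ... | z , _ , z≤e , _ , n≤ , refl
    with two-digits n≤
  ... | v , t , v≤e , t≤e , refl
    = x , y , z , u , v , t , x≤k , y≤e , z≤e , u≤k , v≤e , t≤e , regroup (x * W₅) y z u v t g
    where
    regroup : ∀ x y z u v t g → let w = 1 + g * (g * 1) in
              x + (y * (g * w) + (u * w + (z * (g * g) + (v * g + t)))) ≡
              x + g * (y * w + g * z) + (u * w + g * v) + t
    regroup = solve-∀

  cover-531 : ∀ {A} → Cover g (g * (g * (g * (g * (g * 1))))) (g * (g * (g * 1))) (g * 1)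
                A (g * (g * (g * (g * (g * 1)))) + g * (g * (g * 1)))
  cover-531 _ n≤
    with split-531 1 (≤-trans n≤ (bound
           (G :* (G :* (G :* (G :* (G :* con 1)))) :+ G :* (G :* (G :* con 1)))
           ((con 1 :+ F) :* V₅ :+ (E :* (G :* V₃) :+
             ((con 1 :+ F) :* V₃ :+ (E :* (G :* G) :+ (E :* G :+ E)))))))
  ... | x , y , z , u , v , t , x≤ , y≤e , z≤e , u≤ , v≤e , t≤e , eq
    = _ , _ , _ , wrap (digit (1+f≤e x≤)) (wrap (digit y≤e) (single (digit z≤e)))
    , wrap (digit (1+f≤e u≤)) (single (digit v≤e)) , single (digit t≤e) , eq
    where
    1+f≤e : ∀ {d} → d ≤ 1 + f → d ≤ e
    1+f≤e = subst (_ ≤_) (sym e≡1+f)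

  top-531 : ∀ {n} → W₅ + W₃ ≤ n →
            n ≤ W₅ + W₃ + (f * W₅ + (e * (g * W₃) + (f * W₃ + (e * (g * g) + (e * g + e))))) →
            Sum₃ g n
  top-531 n≥ n≤ with m≤n⇒∃[o]m+o≡n n≥
  ... | o , refl with split-531 0 (+-cancelˡ-≤ (W₅ + W₃) _ _ n≤)
  ...   | x , y , z , u , v , t , x≤ , y≤e , z≤e , u≤ , v≤e , t≤e , refl
    = _ , _ , _ , wrap-palindrome z<s (digit (≤e x≤)) (wrap (digit y≤e) (single (digit z≤e)))
    , wrap-palindrome z<s (digit (≤e u≤)) (single (digit v≤e)) , digit-palindrome (digit t≤e)
    , regroup W₅ W₃ x (g * (y * W₃ + g * z)) u (g * v) t
    where
    regroup : ∀ w w′ x y u v t → w + w′ + (x * w + y + (u * w′ + v) + t) ≡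
                                 (1 + x) * w + y + ((1 + u) * w′ + v) + t
    regroup = solve-∀

  -- Lengths (6,4,3)

  -- The digits of strings of lengths 6, 4 and 3 other than the two outer digits of the first.
  SplitMiddle : ℕ → ℕ → ℕ → Set
  SplitMiddle j r m = ∃ λ z → ∃ λ u → ∃ λ w → ∃ λ v → ∃ λ t →
    z ≤ e × (j ≤ u × u ≤ e) × (j ≤ w × w ≤ e) × v ≤ e × t ≤ e ×
    r + g * m ≡ g * (g * (z * W₂ + g * 0)) + (u * W₄ + g * (v * W₂ + g * 0)) + (w * W₃ + g * t)

  -- D = z(g² + g) + q(g + 1) + r works unless r = g.  Then (u + 1 , w) is traded for
  -- (u , w + 1), which frees g² - g ≡ 2 (mod g + 1); z ↦ z + 1 restores the size.
  exchange : ∀ u w {D} → D ≤ g * (g * g) + g →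
             ∃ λ z → ∃ λ u′ → ∃ λ w′ → ∃ λ v → ∃ λ t →
               z ≤ e × (u ≤ u′ × u′ ≤ suc u) × (w ≤ w′ × w′ ≤ suc w) × v ≤ e × t ≤ e ×
               u′ + w′ ≡ suc u + w ×
               suc u * (g * g) + w * g + D ≡ z * (g * g + g) + (u′ * (g * g) + w′ * g) + (v * W₂ + t)
  exchange u w D≤
    with spread (g * g + g) {0} {e * W₂ + g} e (gap₀ (bound (G :* G :+ G) (con 1 :+ (E :* V₂ :+ G))))
           z≤n
           (≤-trans D≤ (bound (G :* (G :* G) :+ G) (E :* (G :* G :+ G) :+ (E :* V₂ :+ G))))
  ... | z , _ , z≤e , _ , n≤ , refl
    with spread W₂ {0} {g} e (gap₀ (bound V₂ (con 1 :+ G))) z≤n n≤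
  ... | q , r , q≤e , _ , r≤g , refl with r ≤? e
  ...   | yes r≤e = z , suc u , w , q , r , z≤e , (n≤1+n u , ≤-refl) , (≤-refl , n≤1+n w)
            , q≤e , r≤e , refl
            , regroup (suc u * (g * g) + w * g) (z * (g * g + g)) (q * W₂ + r)
    where
    regroup : ∀ s z n → s + (z + n) ≡ z + s + n
    regroup = solve-∀
  exchange u w D≤ | z , _ , z≤e , _ , n≤ , refl | q , r , q≤e , _ , r≤g , refl | no r≰e
    with ≤-antisym r≤g (≤-trans g≤1+e (≰⇒> r≰e))
  exchange u w D≤ | z , _ , z≤e , _ , n≤ , refl | zero , r , q≤e , _ , r≤g , refl | no r≰e | refl
    = z , u , suc w , e , 1 , z≤e , (≤-refl , n≤1+n u) , (n≤1+n w , ≤-refl)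
    , ≤-refl , 1≤e , +-suc u w
    , regroup u w z
    where
    regroup : ∀ u w z → suc u * (g * g) + w * g + (z * (g * g + g) + g) ≡
                        z * (g * g + g) + (u * (g * g) + suc w * g) + (e * W₂ + 1)
    regroup u w z rewrite g≡1+e = expand u w z e
      where
      expand : ∀ u w z e → let g = suc e in
               suc u * (g * g) + w * g + (z * (g * g + g) + g) ≡
               z * (g * g + g) + (u * (g * g) + suc w * g) + (e * (1 + g * 1) + 1)
      expand = solve-∀
  exchange u w D≤ | z , _ , z≤e , _ , n≤ , refl | suc q , r , q≤e , _ , r≤g , refl | no r≰e | refl
    = suc z , u , suc w , q , 1 , ≰⇒> e≰z , (≤-refl , n≤1+n u) , (n≤1+n w , ≤-refl)
    , ≤-trans (n≤1+n q) q≤e , 1≤e , +-suc u w , regroup u w z q g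
    where
    -- If `z` were `e`, the number decomposed would be at least e (g² + g) + `W₂` + g = g³ + g + 1,
    -- just above its bound.
    e≰z : ¬ e ≤ z
    e≰z e≤z = <⇒≱ (bound (con 1 :+ (G :* (G :* G) :+ G)) (E :* (G :* G :+ G) :+ (V₂ :+ G)))
      (≤-trans (+-mono-≤ (*-monoˡ-≤ (g * g + g) e≤z) (+-monoˡ-≤ g (m≤m+n W₂ (q * W₂)))) D≤)
    regroup : ∀ u w z q g → suc u * (g * g) + w * g + (z * (g * g + g) + (suc q * (1 + g * 1) + g)) ≡
              suc z * (g * g + g) + (u * (g * g) + suc w * g) + (q * (1 + g * 1) + 1)
    regroup = solve-∀

  -- The outer digits `suc u` and `w` of the second and third strings must add up to `r` modulo `g`,
  -- with carry `c`. Exchanging a unit between them keeps this sum; the bounds on `u` and `w` leave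
  -- room for it.
  split-middle : ∀ {j r m} c u w → j ≤ u → suc u ≤ e → j ≤ w → suc w ≤ e → r + c * g ≡ suc u + w →
                 c + (suc u * (g * g) + w * g) ≤ m →
                 m ≤ c + (suc u * (g * g) + w * g) + (g * (g * g) + g) → SplitMiddle j r m
  split-middle {j} {r} c u w j≤u u<e j≤w w<e r+cg≡ m≥ m≤ with m≤n⇒∃[o]m+o≡n m≥
  ... | D , refl with exchange u w (+-cancelˡ-≤ (c + (suc u * (g * g) + w * g)) D _ m≤)
  ...   | z , u′ , w′ , v , t , z≤e , (u≤u′ , u′≤) , (w≤w′ , w′≤) , v≤e , t≤e , sum≡ , eq
    = z , u′ , w′ , v , t , z≤e , (≤-trans j≤u u≤u′ , ≤-trans u′≤ u<e)
    , (≤-trans j≤w w≤w′ , ≤-trans w′≤ w<e) , v≤e , t≤e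
    , (begin
        r + g * (c + S + D)
          ≡⟨ pull r g c S D ⟩
        r + c * g + g * (S + D)
          ≡⟨ cong₂ (λ s n → s + g * n) (trans r+cg≡ (sym sum≡)) eq ⟩
        u′ + w′ + g * (z * (g * g + g) + (u′ * (g * g) + w′ * g) + (v * W₂ + t))
          ≡⟨ collect g z u′ w′ v t ⟩
        g * (g * (z * W₂ + g * 0)) + (u′ * W₄ + g * (v * W₂ + g * 0)) + (w′ * W₃ + g * t) ∎)
    where
    open ≡-Reasoning
    S = suc u * (g * g) + w * g
    pull : ∀ r g c s d → r + g * (c + s + d) ≡ r + c * g + g * (s + d)
    pull = solve-∀
    collect : ∀ g z u w v t →
              u + w + g * (z * (g * g + g) + (u * (g * g) + w * g) + (v * (1 + g * 1) + t)) ≡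
              g * (g * (z * (1 + g * 1) + g * 0))
                + (u * (1 + g * (g * (g * 1))) + g * (v * (1 + g * 1) + g * 0))
                + (w * (1 + g * (g * 1)) + g * t)
    collect = solve-∀

  -- Two pairs of outer digits for one residue, with windows that overlap or abut.
  split-middle₂ : ∀ {r m} c u w c′ u′ w′ → suc u ≤ e → suc w ≤ e → suc u′ ≤ e → suc w′ ≤ e →
                  r + c * g ≡ suc u + w → r + c′ * g ≡ suc u′ + w′ →
                  c′ + (suc u′ * (g * g) + w′ * g) ≤
                    suc (c + (suc u * (g * g) + w * g) + (g * (g * g) + g)) →
                  c + (suc u * (g * g) + w * g) ≤ m →
                  m ≤ c′ + (suc u′ * (g * g) + w′ * g) + (g * (g * g) + g) → SplitMiddle 0 r m
  split-middle₂ {m = m} c u w c′ u′ w′ u<e w<e u′<e w′<e eq eq′ gap m≥ m≤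
    with m ≤? c + (suc u * (g * g) + w * g) + (g * (g * g) + g)
  ... | yes m≤₁ = split-middle c u w z≤n u<e z≤n w<e eq m≥ m≤₁
  ... | no m≰₁  = split-middle c′ u′ w′ z≤n u′<e z≤n w′<e eq′ (≤-trans gap (≰⇒> m≰₁)) m≤

  private
    -- start = 3g² - 2g + 1 and start⁺ = 4g² - 2g + 1.
    start : ℕ
    start = g * (3 * f + 4) + 1

    Start : Expr 5
    Start = G :* (con 3 :* F :+ con 4) :+ con 1

    start⁺ : ℕ
    start⁺ = g * (4 * f + 6) + 1

    Start⁺ : Expr 5
    Start⁺ = G :* (con 4 :* F :+ con 6) :+ con 1

    place : Expr 5 → Expr 5 → Expr 5 → Expr 5
    place c u w = c :+ (u :* (G :* G) :+ w :* G)

    reach : Expr 5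
    reach = G :* (G :* G) :+ G

    f<e : suc f ≤ e
    f<e = ≤-reflexive (sym e≡1+f)

    carry : ∀ k → k + 1 * g ≡ 2 + k + f
    carry k = trans (cong (k +_) (trans (*-identityˡ g) (trans g≡1+e (cong suc e≡1+f))))
                    (trans (+-suc k (suc f)) (cong suc (+-suc k f)))

  -- One window for all residues. For residue 0 the outer digits 2 and g - 2 give a window beginning
  -- exactly at `start`. Residues 1 and 2 use the digit sums `r` and `r + g`; larger ones use two
  -- pairs of sum `r`, beginning with 2 and 3.
  split-middle-all : ∀ r {m} → r ≤ e → start ≤ m → m ≤ start + g * (g * g) → SplitMiddle 0 r m
  split-middle-all 0 r≤e m≥ m≤ = split-middle 1 1 f z≤n (bound (con 2) E) z≤n f<e (carry 0)
    (≤-trans (bound (place (con 1) (con 2) F) Start) m≥)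
    (≤-trans m≤ (bound (Start :+ G :* (G :* G)) (place (con 1) (con 2) F :+ reach)))
  split-middle-all 1 r≤e m≥ m≤ = split-middle₂ 0 0 0 1 2 f 1≤e 1≤e (bound (con 3) E) f<e
    refl (carry 1)
    (bound (place (con 1) (con 3) F)
      (con 1 :+ (place (con 0) (con 1) (con 0) :+ reach)))
    (≤-trans (bound (place (con 0) (con 1) (con 0)) Start) m≥)
    (≤-trans m≤ (bound (Start :+ G :* (G :* G)) (place (con 1) (con 3) F :+ reach)))
  split-middle-all 2 r≤e m≥ m≤ = split-middle₂ 0 1 0 1 3 f (bound (con 2) E) 1≤e (bound (con 4) E) f<e
    refl (carry 2)
    (bound (place (con 1) (con 4) F)
      (con 1 :+ (place (con 0) (con 2) (con 0) :+ reach)))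
    (≤-trans (bound (place (con 0) (con 2) (con 0)) Start) m≥)
    (≤-trans m≤ (bound (Start :+ G :* (G :* G)) (place (con 1) (con 4) F :+ reach)))
  split-middle-all (suc (suc (suc r))) r≤e m≥ m≤ = split-middle₂ 0 1 (suc r) 0 2 r
    (bound (con 2) E) (≤-trans (n≤1+n _) r≤e) (bound (con 3) E) (≤-trans (m≤n+m _ 2) r≤e)
    (+-identityʳ _) (+-identityʳ _)
    (boundᵥ (place (con 0) (con 3) J)
      (con 1 :+ (place (con 0) (con 2) (con 1 :+ J) :+ reach)) r)
    (≤-trans (+-monoʳ-≤ (2 * (g * g)) (*-monoˡ-≤ g (≤f (≤-trans (n≤1+n _) r≤e))))
      (≤-trans (bound (con 2 :* (G :* G) :+ F :* G) Start) m≥))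
    (≤-trans m≤ (boundᵥ (Start :+ G :* (G :* G)) (place (con 0) (con 3) J :+ reach) r))

  private
    quotient-≥ : ∀ {k r m} → r ≤ e → g * k ≤ r + g * m → k ≤ m
    quotient-≥ {k} {r} {m} r≤e gk≤ = s≤s⁻¹ (*-cancelˡ-< g k (suc m)
      (≤-trans (s≤s gk≤) (≤-trans (+-monoˡ-≤ (g * m) (digit r≤e)) (≤-reflexive (sym (*-suc g m))))))

    expose : ∀ x r g y m → x + (r + g * (y + m)) ≡ x + (g * y + (r + g * m))
    expose = solve-∀

    regroup : ∀ x g y z u w → x + (g * y + (g * z + u + w)) ≡ x + g * (y + z) + u + w
    regroup = solve-∀

  cover-643 : Cover g (g * (g * (g * (g * (g * (g * 1)))))) (g * (g * (g * (g * 1)))) (g * (g * (g * 1)))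
                (3 * (g * (g * (g * 1))))
                (g * (g * (g * (g * (g * (g * 1))))) + (2 * (g * (g * (g * 1))) + e * (g * (g * 1))))
  cover-643 n≥ n≤
    with spread W₆ {g * start} {g * (e * W₄ + (start + g * (g * g)))} e
           (bound (V₆ :+ G :* Start) (con 1 :+ G :* (E :* V₄ :+ (Start :+ G :* (G :* G)))))
           (≤-trans (bound (G :* Start) (con 3 :* (G :* (G :* (G :* con 1))))) n≥)
           (≤-trans n≤ (bound (G :* (G :* (G :* (G :* (G :* (G :* con 1))))) :+
                                (con 2 :* (G :* (G :* (G :* con 1))) :+ E :* (G :* (G :* con 1))))
                              (E :* V₆ :+ G :* (E :* V₄ :+ (Start :+ G :* (G :* G))))))
  ... | x , N , x≤e , N≥ , N≤ , refl
    with quotient-remainder N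
  ... | r , m , r≤e , refl
    -- The second digit of the first string contributes a multiple of `g`, so it is chosen on the
    -- quotient `m` and leaves `r` alone.
    with spread W₄ {start} {start + g * (g * g)} e (bound (V₄ :+ Start) (con 1 :+ (Start :+ G :* (G :* G))))
           (quotient-≥ r≤e N≥) (*-cancelˡ-≤ g (≤-trans (m≤n+m (g * m) r) N≤))
  ... | y , m′ , y≤e , m′≥ , m′≤ , refl
    with split-middle-all r r≤e m′≥ m′≤
  ... | z , u , w , v , t , z≤e , (_ , u≤e) , (_ , w≤e) , v≤e , t≤e , eq
    = _ , _ , _ , wrap (digit x≤e) (wrap (digit y≤e) (wrap (digit z≤e) empty))
    , wrap (digit u≤e) (wrap (digit v≤e) empty) , wrap (digit w≤e) (single (digit t≤e))
    , trans (expose (x * W₆) r g (y * W₄) m′)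
        (trans (cong (λ n → x * W₆ + (g * (y * W₄) + n)) eq)
          (regroup (x * W₆) g (y * W₄) (g * (z * W₂ + g * 0))
            (u * W₄ + g * (v * W₂ + g * 0)) (w * W₃ + g * t)))

  finish-643 : ∀ {r y m} → y ≤ e → SplitMiddle 1 r m → Sum₃ g (W₆ + (r + g * (y * W₄ + m)))
  finish-643 {r} {y} {m} y≤e (z , u , w , v , t , z≤e , (0<u , u≤e) , (0<w , w≤e) , v≤e , t≤e , eq)
    = _ , _ , _ , wrap-palindrome {d = 1} z<s (digit 1≤e) (wrap (digit y≤e) (wrap (digit z≤e) empty))
    , wrap-palindrome 0<u (digit u≤e) (wrap (digit v≤e) empty)
    , wrap-palindrome 0<w (digit w≤e) (single (digit t≤e))
    , trans (cong (_+ (r + g * (y * W₄ + m))) (sym (*-identityˡ W₆)))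
        (trans (expose (1 * W₆) r g (y * W₄) m)
        (trans (cong (λ n → 1 * W₆ + (g * (y * W₄) + n)) eq)
          (regroup (1 * W₆) g (y * W₄) (g * (z * W₂ + g * 0))
            (u * W₄ + g * (v * W₂ + g * 0)) (w * W₃ + g * t))))

  -- With leading digit 1 fixed, a single pair of outer digits suffices: its window is long enough
  -- for the translates by `W₄` to join up.
  top-643-from : ∀ {r m} c u w → 1 ≤ u → suc u ≤ e → 1 ≤ w → suc w ≤ e → r + c * g ≡ suc u + w →
                 c + (suc u * (g * g) + w * g) ≤ m → m ≤ e * W₄ + g * (g * g) →
                 Sum₃ g (W₆ + (r + g * m))
  top-643-from {m = m} c u w 0<u u<e 0<w w<e r+cg≡ m≥ m≤
    with spread W₄ {s} {s + (g * (g * g) + g)} e gap m≥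
           (≤-trans m≤ (+-monoʳ-≤ (e * W₄) (≤-trans (m≤m+n _ g) (m≤n+m _ s))))
    where
    s = c + (suc u * (g * g) + w * g)
    gap : W₄ + s ≤ suc (s + (g * (g * g) + g))
    gap = ≤-trans (≤-reflexive (+-comm W₄ s)) (≤-trans
      (+-monoʳ-≤ s (bound V₄ (con 1 :+ reach))) (≤-reflexive (+-suc s _)))
  ... | y , m′ , y≤e , m′≥ , m′≤ , refl =
    finish-643 y≤e (split-middle c u w 0<u u<e 0<w w<e r+cg≡ m′≥ m′≤)

  -- For g = 5, numbers that are 3 mod g and lie just above g⁵ need not be sums of
  -- palindromes of lengths 6, 4 and 3; whence the lengths 5, 5 and 3.
  top-553 : ∀ {m} → m ≤ 4 * (g * g) + f * g → Sum₃ g (W₆ + (2 + g * m))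
  -- The outer digits 1, g - 2 and 4 add up to g + 3, matching the units digit 3. Removing their
  -- contribution leaves g times `o + m`, where `o` is g³ - 4g - 1.
  top-553 {m} m≤ with m≤n⇒∃[o]m+o≡n (bound (con 4 :* G :+ con 1) (G :* (G :* (G :* con 1))))
  ... | o , 4g+1+o≡g³
    with split-331 e {o + m} (≤-trans (+-mono-≤ (≤-trans (m≤n+m o (4 * g + 1)) (≤-reflexive 4g+1+o≡g³))
             m≤)
           (bound (G :* (G :* (G :* con 1)) :+ (con 4 :* (G :* G) :+ F :* G))
                  (E :* V₃ :+ (E :* V₃ :+ (E :* G :+ (E :* G :+ E))))))
  ... | x , x′ , y , y′ , t , x≤e , x′≤e , y≤e , y′≤e , t≤e , eq
    = _ , _ , _ , wrap-palindrome {d = 1} z<s (digit 1≤e) (wrap (digit x≤e) (single (digit y≤e)))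
    , wrap-palindrome {d = f} (bound (con 1) F) (digit (≤-trans (n≤1+n f) f<e))
        (wrap (digit x′≤e) (single (digit y′≤e)))
    , wrap-palindrome {d = 4} z<s (digit (bound (con 4) E)) (single (digit t≤e))
    , trans (rebase m) (trans (cong₂ (λ d n → d * W₅ + 4 * W₃ + g * n) e≡1+f eq)
        (distribute W₅ f (4 * W₃) g (x * W₃ + g * y) (x′ * W₃ + g * y′) t))
    where
    expand : ∀ e o m → let g = suc e; g³ = 4 * g + 1 + o in
             1 + g * (g * g³) + (2 + g * m) ≡ e * (1 + g * g³) + 4 * (1 + g * (g * 1)) + g * (o + m)
    expand = solve-∀
    rebase : ∀ m → W₆ + (2 + g * m) ≡ e * W₅ + 4 * W₃ + g * (o + m)
    rebase m = subst (λ g³ → 1 + g * (g * g³) + (2 + g * m) ≡ e * (1 + g * g³) + 4 * W₃ + g * (o + m))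
      4g+1+o≡g³
      (subst (λ g → 1 + g * (g * (4 * g + 1 + o)) + (2 + g * m) ≡
                    e * (1 + g * (4 * g + 1 + o)) + 4 * (1 + g * (g * 1)) + g * (o + m))
        (sym g≡1+e) (expand e o m))
    distribute : ∀ w f c g p q t → suc f * w + c + g * (p + q + t) ≡
                 1 * w + g * p + (f * w + g * q) + (c + g * t)
    distribute = solve-∀

  -- Digits must stay nonzero after an exchange, so residues 1 and 2 now take the digit sum `r + g`.
  -- The window for residue 1 begins exactly at `start⁺`; that for residue 2 begins later, and
  -- `top-553` fills the difference.
  top-643 : ∀ {n} → W₆ + g * start⁺ ≤ n → n ≤ W₆ + g * (e * W₄ + g * (g * g)) →
            Sum₃ g n
  top-643 n≥ n≤ with m≤n⇒∃[o]m+o≡n (m+n≤o⇒m≤o W₆ n≥)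
  ... | N , refl with quotient-remainder N
  ...   | r , m , r≤e , refl = by-residue r r≤e
            (quotient-≥ r≤e (+-cancelˡ-≤ W₆ _ _ n≥))
            (*-cancelˡ-≤ g (≤-trans (m≤n+m (g * m) r) (+-cancelˡ-≤ W₆ _ _ n≤)))
    where
    by-residue : ∀ r {m} → r ≤ e → start⁺ ≤ m → m ≤ e * W₄ + g * (g * g) →
                 Sum₃ g (W₆ + (r + g * m))
    by-residue 0 r≤e m≥ = top-643-from 1 1 f ≤-refl (bound (con 2) E) (bound (con 1) F) f<e (carry 0)
      (≤-trans (bound (place (con 1) (con 2) F) Start⁺) m≥)
    by-residue 1 r≤e m≥ = top-643-from 1 2 f (s≤s z≤n) (bound (con 3) E) (bound (con 1) F) f<e (carry 1)
      (≤-trans (bound (place (con 1) (con 3) F) Start⁺) m≥)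
    by-residue 2 {m} r≤e m≥ m≤ with suc (4 * (g * g) + f * g) ≤? m
    ... | yes m≥′ = top-643-from 1 3 f (s≤s z≤n) (bound (con 4) E) (bound (con 1) F) f<e (carry 2)
                        m≥′ m≤
    ... | no m≱   = top-553 (s≤s⁻¹ (≰⇒> m≱))
    by-residue (suc (suc (suc r))) r≤e m≥ = top-643-from 0 1 (suc r) ≤-refl (bound (con 2) E) (s≤s z≤n)
      (≤-trans (n≤1+n _) r≤e) (+-identityʳ _)
      (≤-trans (+-monoʳ-≤ (2 * (g * g)) (*-monoˡ-≤ g (≤f (≤-trans (n≤1+n _) r≤e))))
        (≤-trans (bound (con 2 :* (G :* G) :+ F :* G) Start⁺) m≥))

  -- Iterated growth of four families of lengths

  square-power : ℕ → ℕ
  square-power zero    = 1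
  square-power (suc k) = g * (g * square-power k)

  square-power-positive : ∀ k → 0 < square-power k
  square-power-positive zero    = z<s
  square-power-positive (suc k) =
    *-mono-≤ (digit {0} z≤n) (*-mono-≤ (digit {0} z≤n) (square-power-positive k))

  k≤square-power : ∀ k → k ≤ square-power k
  k≤square-power zero    = z≤n
  k≤square-power (suc k) = ≤-trans (s≤s (k≤square-power k))
    (bound⁺ (con 1 :+ J) (G :* (G :* J)) (square-power-positive k) tt)

  private
    up : Vec (Expr 5) 5
    up = G ∷ E ∷ F ∷ D ∷ G :* (G :* J) ∷ []

    W : Expr 5 → Expr 5
    W p = con 1 :+ G :* p

  -- The expressions are in J = g ^ (2k): p₁, p₂, p₃ are the g ^ length and [α , β] is the window.
  record Family : Set where
    field
      p₁ p₂ p₃ α β : Expr 5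

    low : Expr 5
    low = G :* α :+ E :* W p₃

    lowest : Expr 5
    lowest = W p₁ :+ (W p₂ :+ (W p₂ :+ low))

    highest : Expr 5
    highest = W p₁ :+ (W p₂ :+ (F :* W p₁ :+ (D :* W p₂ :+ G :* β)))

    field
      scaled₁ : ∀ j → ⟦ p₁ ⟧ (at (g * (g * j))) ≡ g * (g * ⟦ p₁ ⟧ (at j))
      scaled₂ : ∀ j → ⟦ p₂ ⟧ (at (g * (g * j))) ≡ g * (g * ⟦ p₂ ⟧ (at j))
      scaled₃ : ∀ j → ⟦ p₃ ⟧ (at (g * (g * j))) ≡ g * (g * ⟦ p₃ ⟧ (at j))
      -- `gap₂` and `gap₁` are the premises of `grow`, `top₂` and `top₁` those of `top`. By `lower`
      -- and `upper` the window of the next level lies inside the grown interval.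
      gap₂    : Dominates⁺ (W p₂ :+ low) (con 1 :+ G :* β)
      gap₁    : Dominates⁺ (W p₁ :+ low) (con 1 :+ (E :* W p₂ :+ G :* β))
      lower   : Dominates⁺ low (α [ up ])
      upper   : Dominates⁺ (β [ up ]) (E :* W p₁ :+ (E :* W p₂ :+ G :* β))
      top₂    : Dominates⁺ (W p₂ :+ (W p₂ :+ low)) (con 1 :+ G :* β)
      top₁    : Dominates⁺ (W p₁ :+ (W p₂ :+ low)) (con 1 :+ (D :* W p₂ :+ G :* β))

    CoverAt : ℕ → Set
    CoverAt j = Cover g (⟦ p₁ ⟧ (at j)) (⟦ p₂ ⟧ (at j)) (⟦ p₃ ⟧ (at j))
                      (⟦ α ⟧ (at j)) (⟦ β ⟧ (at j))

    cover-next : ∀ {j} → 0 < j → CoverAt j → CoverAt (g * (g * j))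
    cover-next {j} 0<j cover n≥ n≤
      rewrite scaled₁ j | scaled₂ j | scaled₃ j =
      grow cover (bound⁺ (W p₂ :+ low) (con 1 :+ G :* β) 0<j gap₂)
        (bound⁺ (W p₁ :+ low) (con 1 :+ (E :* W p₂ :+ G :* β)) 0<j gap₁)
        (≤-trans (≤-trans (bound⁺ low (α [ up ]) 0<j lower) (≤-reflexive (⟦⟧-[] α up (at j)))) n≥)
        (≤-trans n≤ (≤-trans (≤-reflexive (sym (⟦⟧-[] β up (at j))))
          (bound⁺ (β [ up ]) (E :* W p₁ :+ (E :* W p₂ :+ G :* β)) 0<j upper)))

    cover-all : CoverAt 1 → ∀ k → CoverAt (square-power k)
    cover-all base zero    = base
    cover-all base (suc k) = cover-next (square-power-positive k) (cover-all base k)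

    top-all : CoverAt 1 → ∀ k {n} → ⟦ lowest ⟧ (at (square-power k)) ≤ n →
              n ≤ ⟦ highest ⟧ (at (square-power k)) → Sum₃ g n
    top-all base k = top (cover-all base k) f d (≤-reflexive (sym e≡1+f))
      (≤-reflexive (trans (cong (2 +_) d≡2+h) (sym e≡4+h)))
      (bound⁺ (W p₂ :+ (W p₂ :+ low)) (con 1 :+ G :* β) (square-power-positive k) top₂)
      (bound⁺ (W p₁ :+ (W p₂ :+ low)) (con 1 :+ (D :* W p₂ :+ G :* β)) (square-power-positive k) top₁)

  open Family

  private
    G¹ G² G³ G⁴ G⁵ G⁶ : Expr 5
    G¹ = G :* J
    G² = G :* G¹
    G³ = G :* G²
    G⁴ = G :* G³
    G⁵ = G :* G⁴
    G⁶ = G :* G⁵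

  -- At `J = 1` the windows are those of the base covers. For (3,2,1) and (5,3,1) the summand `J` in
  -- `α` absorbs the constant `e` in `low`, without which `lower` would fail.
  family-321 family-531 family-431 family-643 : Family
  family-321 = record
    { p₁ = G³ ; p₂ = G² ; p₃ = G¹ ; α = G¹ :+ J ; β = G³ :+ G²
    ; scaled₁ = λ _ → refl ; scaled₂ = λ _ → refl ; scaled₃ = λ _ → refl
    ; gap₂ = tt ; gap₁ = tt ; lower = tt ; upper = tt ; top₂ = tt ; top₁ = tt }
  family-531 = record
    { p₁ = G⁵ ; p₂ = G³ ; p₃ = G¹ ; α = G¹ :+ J ; β = G⁵ :+ G³
    ; scaled₁ = λ _ → refl ; scaled₂ = λ _ → refl ; scaled₃ = λ _ → refl
    ; gap₂ = tt ; gap₁ = tt ; lower = tt ; upper = tt ; top₂ = tt ; top₁ = tt }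
  family-431 = record
    { p₁ = G⁴ ; p₂ = G³ ; p₃ = G¹ ; α = G² :+ J ; β = G⁴ :+ F :* G²
    ; scaled₁ = λ _ → refl ; scaled₂ = λ _ → refl ; scaled₃ = λ _ → refl
    ; gap₂ = tt ; gap₁ = tt ; lower = tt ; upper = tt ; top₂ = tt ; top₁ = tt }
  family-643 = record
    { p₁ = G⁶ ; p₂ = G⁴ ; p₃ = G³ ; α = con 3 :* G³ ; β = G⁶ :+ (con 2 :* G³ :+ E :* G²)
    ; scaled₁ = λ _ → refl ; scaled₂ = λ _ → refl ; scaled₃ = λ _ → refl
    ; gap₂ = tt ; gap₁ = tt ; lower = tt ; upper = tt ; top₂ = tt ; top₁ = tt }

  -- Overlapping ranges exhaust the numbers

  UpTo : ℕ → Set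
  UpTo a = ∀ {n} → n ≤ a → Sum₃ g n

  extend : ∀ {a lo hi} → (∀ {n} → lo ≤ n → n ≤ hi → Sum₃ g n) → lo ≤ suc a → UpTo a → UpTo hi
  extend {a} between lo≤ below {n} n≤hi with n ≤? a
  ... | yes n≤a = below n≤a
  ... | no n≰a  = between (≤-trans lo≤ (≰⇒> n≰a)) n≤hi

  -- From the innermost call outwards the lengths are (3,3,1), (4,3,1), (5,3,1), (5,4,3), (6,4,3),
  -- (6,5,3), (7,5,3).
  up-to-first : UpTo (⟦ highest family-531 ⟧ (at 1))
  up-to-first =
    extend (top-all family-531 cover-531 0)
      (bound⁺ (lowest family-531) (con 1 :+ highest family-431) {1} z<s tt)
    (extend (top-all family-431 cover-431 0) (bound (lowest family-431 [ one ]) (con 1 :+ hi-643))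
    (extend top-643 (bound (V₆ :+ G :* Start⁺) (con 1 :+ highest family-321 [ one ]))
    (extend (top-all family-321 cover-321 0) (bound (lowest family-321 [ one ]) (con 1 :+ hi-531))
    (extend top-531 (bound (V₅ :+ V₃) (con 1 :+ hi-431))
    (extend top-431 (bound (V₄ :+ con 2 :* V₃) (con 1 :+ hi-331))
    (extend top-331 (bound (V₃ :+ V₃) (con 1 :+ (E :* V₃ :+ G :* G)))
    up-to-three-digits))))))
    where
    one : Vec (Expr 5) 5
    one = G ∷ E ∷ F ∷ D ∷ con 1 ∷ []
    hi-331 hi-431 hi-531 hi-643 : Expr 5
    hi-331 = V₃ :+ V₃ :+ (F :* V₃ :+ (F :* V₃ :+ (E :* G :+ (E :* G :+ E))))
    hi-431 = V₄ :+ (F :* V₄ :+ (F :* (G :* V₂) :+ (E :* V₃ :+ G :* G)))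
    hi-531 = V₅ :+ V₃ :+ (F :* V₅ :+ (E :* (G :* V₃) :+ (F :* V₃ :+ (E :* (G :* G) :+ (E :* G :+ E)))))
    hi-643 = V₆ :+ G :* (E :* V₄ :+ G :* (G :* G))

  -- One round passes through the families (3,2,1), (6,4,3), (4,3,1), (5,3,1). The family (6,4,3)
  -- has index `k` instead of `suc k`, its starting lengths being already one level further on.
  up-to : ∀ k → UpTo (⟦ highest family-531 ⟧ (at (square-power k)))
  up-to zero    = up-to-first
  up-to (suc k) =
    extend (top-all family-531 cover-531 (suc k))
      (next (lowest family-531 [ up ]) (highest family-431 [ up ]) tt)
    (extend (top-all family-431 cover-431 (suc k))
      (next (lowest family-431 [ up ]) (highest family-643) tt)
    (extend (top-all family-643 cover-643 k)
      (next (lowest family-643) (highest family-321 [ up ]) tt)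
    (extend (top-all family-321 cover-321 (suc k))
      (next (lowest family-321 [ up ]) (highest family-531) tt)
    (up-to k))))
    where
    next : ∀ a b → Dominates⁺ a (con 1 :+ b) →
           ⟦ a ⟧ (at (square-power k)) ≤ suc (⟦ b ⟧ (at (square-power k)))
    next a b = bound⁺ a (con 1 :+ b) (square-power-positive k)

  sum-of-three : ∀ n → Sum₃ g n
  sum-of-three n = up-to n (≤-trans (k≤square-power n)
    (bound⁺ J (highest family-531) (square-power-positive n) tt))

theorem1p1 : (g : ℕ) → 5 ≤ g → (n : ℕ) → 0 < n →
    ∃ λ a → ∃ λ b → ∃ λ c →
    IsPalindrome g a × IsPalindrome g b × IsPalindrome g c × n ≡ a + b + c
theorem1p1 g 5≤g n 0<n with m≤n⇒∃[o]m+o≡n 5≤g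
... | h , 5+h≡g = LargeBase.sum-of-three g (4 + h) (3 + h) (2 + h) h (sym 5+h≡g) refl refl refl n
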